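{- Let $H$ be a bipartite graph on $h$ vertices. Let $m\in\mathbb{N}$ and let $n$ be given by $2n=mh$; below, $G$ denotes a balanced bipartite graph on $2n=mh$ vertices. (1) If $hcf(H)\neq 1$, then there exists a $G$ such that $\delta(G)=\lceil \frac{n}{2}\rceil-1$ and $G$ does not contain an $H$-factor. (2) If $hcf(H)=1$, then there exists a $G$ such that $\delta(G)=\left(1-\frac{1}{\chi_{cr}(H)}\right)n-1$ and $G$ does not contain an $H$-factor.
   Context: A bipartite graph is balanced if its two partition sets have the same size (so $G$ has $n$ vertices in each partition set). $\delta(G)$ is the minimum degree of $G$. For a graph $H$ on $h$ vertices and a graph $G$ on $N$ vertices, an $H$-factor of $G$ is a subgraph of $G$ consisting of $\lfloor N/h\rfloor$ vertex-disjoint copies of $H$. The bipartite graph $H$ is understood to have chromatic number $\chi(H)=2$. $\sigma(H)$ is the size of the smallest color class over all proper 2-colorings of $H$, and $\chi_{cr}(H)=\frac{(\chi(H)-1)h}{h-\sigma(H)}=\frac{h}{h-\sigma(H)}$; thus $1-1/\chi_{cr}(H)=\sigma(H)/h$. $hcf_c(H)$ is the highest common factor of the numbers of vertices of the connected components of $H$. For a proper 2-coloring of $H$ with color classes of sizes $x_1\le x_2$ consider the difference $x_2-x_1$; let $D(H)$ be the set of these differences over all proper 2-colorings of $H$. $hcf_\chi(H)$ is the highest common factor of the elements of $D(H)$, with $hcf_\chi(H)=\infty$ if $D(H)=\{0\}$. For bipartite $H$ (that is, $\chi(H)=2$), one says $hcf(H)=1$ if and only if both $hcf_c(H)=1$ and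 $hcf_\chi(H)\le 2$; otherwise $hcf(H)\neq 1$.
   Formalization: In (2) the minimum degree is taken as ⌈(1−1/χ_cr(H))n⌉−1, since (1−1/χ_cr(H))n need not be an integer (e.g. H = K_{1,2}+K_1, m = 1 gives −1/2); m is taken to be positive. -}

module Defs where

open import Data.Bool.Base using (Bool; false; T)
open import Data.Fin.Base using (Fin)
open import Data.Fin.Subset using (Subset; _∈_; ∣_∣; ∁)
open import Data.Fin.Subset.Properties using (∣∁p∣≡n∸∣p∣)
open import Data.Integer.Base using (+_)
open import Data.Nat.Base as ℕ
  using (ℕ; _≤_; _∸_; _/_; NonZero; ≢-nonZero; ≢-nonZero⁻¹; ∣_-_∣)
open import Data.Nat.Divisibility using (_∣_)
open import Data.Nat.Properties using (n≤0⇒n≡0; *-identityˡ)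
open import Data.Product.Base using (∃; Σ-syntax; _×_; _,_)
open import Data.Rational.Base as ℚ using (ℚ)
import Data.Rational.Properties as ℚ
open import Data.Vec.Base using (lookup; tabulate)
open import Data.Bool.Properties using (not-injective)
open import Data.Vec.Properties using (lookup-map)
open import Function.Bundles using (_⇔_)
open import Function.Definitions using (Injective)
open import Relation.Binary.Construct.Closure.ReflexiveTransitive using (Star)
import Relation.Binary.Construct.Add.Supremum.NonStrict as NonStrict
open import Relation.Binary.PropositionalEquality
  using (_≡_; _≢_; refl; sym; trans; cong; subst)
open import Relation.Nullary.Construct.Add.Supremum using (_⁺; ⊤⁺; [_])
open import Relation.Nullary.Negation.Core using (¬_)

IsLeast : (ℕ → Set) → ℕ → Set
IsLeast P k = P k × (∀ j → P j → k ≤ j)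

-- As for the library's binary GCD, "highest" refers to divisibility.
IsHCF : (ℕ → Set) → ℕ → Set
IsHCF P g = (∀ x → P x → g ∣ x) × (∀ d → (∀ x → P x → d ∣ x) → d ∣ g)

record Graph (n : ℕ) : Set where
  field
    adj         : Fin n → Fin n → Bool
    adj-sym     : ∀ u v → adj u v ≡ adj v u
    adj-irrefl  : ∀ v → adj v v ≡ false

  Edge : Fin n → Fin n → Set
  Edge u v = T (adj u v)

  degree : Fin n → ℕ
  degree v = ∣ tabulate (adj v) ∣

open Graph public

module _ {n : ℕ} (G : Graph n) where

  IsMinDegree : ℕ → Set
  IsMinDegree = IsLeast (λ d → ∃ λ v → degree G v ≡ d)

  Colourable : ℕ → Set
  Colourable k = Σ[ c ∈ (Fin n → Fin k) ] (∀ u v → Edge G u v → c u ≢ c v)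

  IsChromaticNumber : ℕ → Set
  IsChromaticNumber = IsLeast Colourable

  -- A 2-colouring is given by one of its classes X, the other being ∁ X.
  Proper₂ : Subset n → Set
  Proper₂ X = ∀ u v → Edge G u v → lookup X u ≢ lookup X v

  BalancedBipartite : Set
  BalancedBipartite = Σ[ X ∈ Subset n ] (Proper₂ X × ∣ X ∣ ≡ ∣ ∁ X ∣)

  -- Both classes of a 2-colouring are covered, because Proper₂ X implies
  -- Proper₂ (∁ X).
  ClassSize : ℕ → Set
  ClassSize s = Σ[ X ∈ Subset n ] (Proper₂ X × ∣ X ∣ ≡ s)

  Isσ : ℕ → Set
  Isσ = IsLeast ClassSize

  ComponentSize : ℕ → Set
  ComponentSize k =
    Σ[ v ∈ Fin n ] Σ[ C ∈ Subset n ]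
      ((∀ w → w ∈ C ⇔ Star (Edge G) v w) × ∣ C ∣ ≡ k)

  D : ℕ → Set
  D d = Σ[ X ∈ Subset n ] (Proper₂ X × ∣ ∣ X ∣ - ∣ ∁ X ∣ ∣ ≡ d)

  -- ℕ ⁺ is ℕ with a top element ⊤⁺ playing the role of ∞.
  data IsHCFχ : ℕ ⁺ → Set where
    infinite : (∀ d → D d ⇔ d ≡ 0) → IsHCFχ ⊤⁺
    finite   : ∀ {g} → ¬ (∀ d → D d ⇔ d ≡ 0) → IsHCF D g → IsHCFχ [ g ]

  open NonStrict _≤_ using (_≤⁺_)

  HCF≡1 : Set
  HCF≡1 = IsHCF ComponentSize 1 × (∃ λ g → IsHCFχ g × g ≤⁺ [ 2 ])

module _ {h N : ℕ} (H : Graph h) (G : Graph N) where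

  record Copy : Set where
    field
      embed     : Fin h → Fin N
      injective : Injective _≡_ _≡_ embed
      edges     : ∀ u v → Edge H u v → Edge G (embed u) (embed v)

  open Copy public

  HFactor : .{{_ : NonZero h}} → Set
  HFactor = Σ[ copy ∈ (Fin (N / h) → Copy) ]
    (∀ i j → i ≢ j → ∀ u v → embed (copy i) u ≢ embed (copy j) v)

module _ {h : ℕ} .{{_ : NonZero h}} (H : Graph h) {σ : ℕ} (isσ : Isσ H σ) where

  private
    proper-∁ : ∀ X → Proper₂ H X → Proper₂ H (∁ X)
    proper-∁ X p u v e eq = p u v e (not-injective
      (trans (sym (lookup-map u _ X)) (trans eq (lookup-map v _ X))))

    σ≤h∸σ : Isσ H σ → σ ≤ h ∸ σ
    σ≤h∸σ ((X , p , refl) , least) =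
      least _ (∁ X , proper-∁ X p , ∣∁p∣≡n∸∣p∣ X)

  h∸σ-nonZero : NonZero (h ∸ σ)
  h∸σ-nonZero = ≢-nonZero λ eq →
    let σ≡0 = n≤0⇒n≡0 (subst (σ ≤_) eq (σ≤h∸σ isσ))
    in  ≢-nonZero⁻¹ h (trans (cong (h ∸_) (sym σ≡0)) eq)

  -- The general formula (χ - 1)h / (h - σ), for χ = 2.
  χcr : ℚ
  χcr = (+ ((2 ∸ 1) ℕ.* h) ℚ./ (h ∸ σ)) {{h∸σ-nonZero}}

  χcr-nonZero : ℚ.NonZero χcr
  χcr-nonZero = ℚ.pos⇒nonZero χcr {{ℚ.normalize-pos ((2 ∸ 1) ℕ.* h) (h ∸ σ)
    {{h∸σ-nonZero}} {{1*h-nonZero}}}}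
    where
    1*h-nonZero : NonZero ((2 ∸ 1) ℕ.* h)
    1*h-nonZero = ≢-nonZero λ eq → ≢-nonZero⁻¹ h (trans (sym (*-identityˡ h)) eq)

  1-1/χcr : ℚ
  1-1/χcr = ℚ.1ℚ ℚ.- (ℚ.1/ χcr) {{χcr-nonZero}}

{-# OPTIONS --safe #-}

-- All the graphs G are disjoint unions of two bicliques K(A₁,B₁) and K(A₂,B₂)
-- with |A₁| + |A₂| = |B₁| + |B₂| = n. An H-factor of G covers all vertices, so
-- it writes the size of any vertex set as a sum over the copies of H, and
-- proper 2-colourings and unions of components of G restrict to such in each
-- copy. The colour class A₁ ∪ B₂ has |A₁ ∪ B₂| ≥ mσ if there is an H-factor,
-- and its difference is a multiple of any common divisor of D(H); the size of
-- A₁ ∪ B₁ is a multiple of hcf_c(H). Take |A₁| = δ. If D(H) has a common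
-- divisor ≥ 3, then |B₁| = |A₁| + 1 gives a difference of 2. If hcf_c(H) ≥ 2,
-- then it fails to divide |A₁| + |B₁| for |B₁| = |A₁| + 1 or |B₁| = |A₁|.
-- For (2), |B₁| = n - |A₁| gives |A₁ ∪ B₂| = 2δ < mσ.

module Submission where

open import Defs
open import Data.Bool.Base
  using (Bool; true; false; not; _∧_; _xor_; T; if_then_else_)
import Data.Bool.Properties as Bool
open import Data.Fin.Base
  using (Fin; zero; suc; punchIn; punchOut; _↑ˡ_; _↑ʳ_; combine; remQuot)
import Data.Fin.Properties as Fin
open import Data.Fin.Subset using (Subset; ∣_∣; ∁; _∩_; _∈_; ⊤)
open import Data.Fin.Subset.Properties
  using (anySubset?; ∣∁p∣≡n∸∣p∣; ∣p∣≤n; nonempty?; ∣⊤∣≡n; ∣⊥∣≡0; Empty-unique;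
         x∈p∩q⁺; x∈p∩q⁻; x∈p⇒∣p-x∣<∣p∣)
open import Data.Integer.Base as ℤ using (+_; +[1+_]; 1ℤ)
import Data.Integer.Divisibility.Signed as ℤs
import Data.Integer.DivMod as ℤ
import Data.Integer.Properties as ℤ
open import Data.Integer.Tactic.RingSolver
  using () renaming (solve-∀ to ℤ-solve-∀)
open import Data.Nat.Base
open import Data.Nat.Divisibility
open import Data.Nat.DivMod using (/-congˡ; m*n/n≡m; m/n*n≡m)
open import Data.Nat.Induction using (<-wellFounded; Acc; acc)
open import Data.Nat.Properties
open import Data.Nat.Tactic.RingSolver
  using () renaming (solve-∀ to ℕ-solve-∀)
open import Data.Product.Base
  using (∃; Σ-syntax; _×_; _,_; proj₁; proj₂; uncurry)
open import Data.Rational.Base as ℚ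
  using (mkℚ; ceiling; toℚᵘ; ↥_; ↧_; ↧ₙ_)
import Data.Rational.Properties as ℚ
open import Data.Rational.Unnormalised.Base as ℚᵘ using (mkℚᵘ; *≡*; _≃_)
import Data.Rational.Unnormalised.Properties as ℚᵘ
open import Data.Sum.Base using (_⊎_; inj₁; inj₂; [_,_]′)
open import Data.Vec.Base
  using (Vec; []; _∷_; _++_; replicate; map; tabulate; lookup)
open import Data.Vec.Properties
  using (lookup∘tabulate; tabulate∘lookup; tabulate-∘; tabulate-cong;
         lookup-map; map-∘; lookup-zipWith; lookup-replicate; []=⇒lookup;
         lookup⇒[]=)
open import Effect.Monad using (RawMonad)
open import Function.Base using (_∘_; it)
open import Function.Bundles using (_⇔_; mk⇔; Equivalence)
open import Function.Definitions using (Injective)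
open import Level using (0ℓ)
import Relation.Binary.Construct.Add.Supremum.NonStrict as NonStrict
open import Relation.Binary.Construct.Closure.ReflexiveTransitive
  using (Star; ε; _◅_; _◅◅_)
open import Relation.Binary.PropositionalEquality
open import Relation.Nullary.Construct.Add.Supremum using ([_])
open import Relation.Nullary.Decidable
  using (Dec; yes; no; does; map′; ¬?; _×-dec_; _→-dec_; decidable-stable;
         dec-true; does-⇔; ¬¬-excluded-middle)
open import Relation.Nullary.Negation
  using (¬_; contradiction; ¬¬-map; ¬¬-Monad)
open import Relation.Unary using (Decidable)

open import Algebra.Properties.CommutativeMonoid.Sum +-0-commutativeMonoid
  using (sum; sum-remove; sum-cong-≗)

-- Sums over finite index sets and their reindexing

-- An injective self-map of `Fin n` is a permutation. The induction takes out the index `f zero`;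
-- the remaining values of `f`, punched out at `f zero`, form an injective self-map of the smaller
-- set.
sum-injective : ∀ {n} (t : Fin n → ℕ) {f : Fin n → Fin n} → Injective _≡_ _≡_ f →
                sum (t ∘ f) ≡ sum t
sum-injective {zero}  t         inj = refl
sum-injective {suc n} t {f} inj = begin
  t (f zero) + sum (t ∘ f ∘ suc)
    ≡⟨ cong (_+_ (t (f zero))) (sum-cong-≗ (cong t ∘ sym ∘ Fin.punchIn-punchOut ∘ f₀≢)) ⟩
  t (f zero) + sum (t ∘ punchIn (f zero) ∘ λ i → punchOut (f₀≢ i))
    ≡⟨ cong (_+_ (t (f zero))) (sum-injective (t ∘ punchIn (f zero))
         (Fin.suc-injective ∘ inj ∘ Fin.punchOut-injective (f₀≢ _) (f₀≢ _))) ⟩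
  t (f zero) + sum (t ∘ punchIn (f zero))
    ≡⟨ sum-remove {i = f zero} t ⟨
  sum t ∎
  where
  open ≡-Reasoning
  f₀≢ : ∀ i → f zero ≢ f (suc i)
  f₀≢ i eq with () ← inj eq

sum-↑ : ∀ m {n} (t : Fin (m + n) → ℕ) → sum t ≡ sum (t ∘ (_↑ˡ n)) + sum (t ∘ (m ↑ʳ_))
sum-↑ zero    t = refl
sum-↑ (suc m) t = trans (cong (_+_ (t zero)) (sum-↑ m (t ∘ suc))) (sym (+-assoc (t zero) _ _))

sum-combine : ∀ k {h} (t : Fin (k * h) → ℕ) → sum t ≡ sum (λ i → sum (t ∘ combine {k} i))
sum-combine zero    t = refl
sum-combine (suc k) {h} t =
  trans (sum-↑ h t) (cong (_+_ (sum (t ∘ (_↑ˡ k * h)))) (sum-combine k (t ∘ (h ↑ʳ_))))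

∣tabulate∣ : ∀ {n} (S : Fin n → Bool) →
             ∣ tabulate S ∣ ≡ sum (λ i → if S i then 1 else 0)
∣tabulate∣ {zero}  S = refl
∣tabulate∣ {suc n} S with S zero
... | true  = cong suc (∣tabulate∣ (S ∘ suc))
... | false = ∣tabulate∣ (S ∘ suc)

-- Disjointness glues the maps `f i` into one injection of `Fin (k * h)`, and `k * h ≡ N` makes it a
-- self-map, so that `sum-injective` applies. This is where a factor is seen to cover all vertices.
sum-disjoint-images : ∀ {k h N} → k * h ≡ N → (t : Fin N → ℕ) (f : Fin k → Fin h → Fin N) →
  (∀ i → Injective _≡_ _≡_ (f i)) → (∀ i j → i ≢ j → ∀ u v → f i u ≢ f j v) →
  sum (λ i → sum (t ∘ f i)) ≡ sum t
sum-disjoint-images {k} {h} refl t f inj disjoint = begin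
  sum (λ i → sum (t ∘ f i))
    ≡⟨ sum-cong-≗ (λ i → sum-cong-≗ (λ u → cong (t ∘ uncurry f) (Fin.remQuot-combine {k} i u))) ⟨
  sum (λ i → sum (λ u → t (F (combine {k} i u))))
    ≡⟨ sum-combine k {h} (t ∘ F) ⟨
  sum (t ∘ F)
    ≡⟨ sum-injective t F-injective ⟩
  sum t ∎
  where
  open ≡-Reasoning
  F : Fin (k * h) → Fin (k * h)
  F = uncurry f ∘ remQuot {k} h

  f-injective : ∀ {p q} → uncurry f p ≡ uncurry f q → p ≡ q
  f-injective {i , u} {j , v} eq with i Fin.≟ j
  ... | no i≢j = contradiction eq (disjoint i j i≢j u v)
  ... | yes refl = cong (i ,_) (inj i eq)

  F-injective : Injective _≡_ _≡_ F
  F-injective {x} {y} eq = begin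
    x                               ≡⟨ Fin.combine-remQuot {k} h x ⟨
    uncurry combine (remQuot {k} h x) ≡⟨ cong (uncurry combine) (f-injective eq) ⟩
    uncurry combine (remQuot {k} h y) ≡⟨ Fin.combine-remQuot {k} h y ⟩
    y ∎

-- Divisibility of sums and of distances

∣⊖∣≡∣-∣ : ∀ m n → ℤ.∣ m ℤ.⊖ n ∣ ≡ ∣ m - n ∣
∣⊖∣≡∣-∣ zero    zero    = refl
∣⊖∣≡∣-∣ zero    (suc n) = refl
∣⊖∣≡∣-∣ (suc m) zero    = refl
∣⊖∣≡∣-∣ (suc m) (suc n) = trans (cong ℤ.∣_∣ (ℤ.[1+m]⊖[1+n]≡m⊖n m n)) (∣⊖∣≡∣-∣ m n)

-- Distances do not add up, but signed differences do, and `g` divides one exactly when it divides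
-- the other.
∣-distance-+ : ∀ {g} m n p q → g ∣ ∣ m - n ∣ → g ∣ ∣ p - q ∣ → g ∣ ∣ m + p - (n + q) ∣
∣-distance-+ {g} m n p q g∣m-n g∣p-q = subst (g ∣_) (∣⊖∣≡∣-∣ (m + p) (n + q))
  (ℤs.∣⇒∣ᵤ (subst (ℤ.+ g ℤs.∣_) eq
    (ℤs.∣m∣n⇒∣m+n (signed m n g∣m-n) (signed p q g∣p-q))))
  where
  open ≡-Reasoning
  signed : ∀ m n → g ∣ ∣ m - n ∣ → ℤ.+ g ℤs.∣ (m ℤ.⊖ n)
  signed m n = ℤs.∣ᵤ⇒∣ ∘ subst (g ∣_) (sym (∣⊖∣≡∣-∣ m n))

  swap : ∀ m n p q → (m ℤ.- n) ℤ.+ (p ℤ.- q) ≡ (m ℤ.+ p) ℤ.- (n ℤ.+ q)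
  swap = ℤ-solve-∀

  eq : (m ℤ.⊖ n) ℤ.+ (p ℤ.⊖ q) ≡ (m + p) ℤ.⊖ (n + q)
  eq = begin
    (m ℤ.⊖ n) ℤ.+ (p ℤ.⊖ q)
      ≡⟨ cong₂ ℤ._+_ (ℤ.m-n≡m⊖n m n) (ℤ.m-n≡m⊖n p q) ⟨
    (ℤ.+ m ℤ.- ℤ.+ n) ℤ.+ (ℤ.+ p ℤ.- ℤ.+ q)
      ≡⟨ swap (ℤ.+ m) (ℤ.+ n) (ℤ.+ p) (ℤ.+ q) ⟩
    ℤ.+ (m + p) ℤ.- ℤ.+ (n + q)
      ≡⟨ ℤ.m-n≡m⊖n (m + p) (n + q) ⟩
    (m + p) ℤ.⊖ (n + q) ∎

∣-sum : ∀ {d k} (t : Fin k → ℕ) → (∀ i → d ∣ t i) → d ∣ sum t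
∣-sum {d} {zero}  t d∣t = d ∣0
∣-sum {d} {suc k} t d∣t = ∣m∣n⇒∣m+n (d∣t zero) (∣-sum (t ∘ suc) (d∣t ∘ suc))

∣-distance-sum : ∀ {g k} (t u : Fin k → ℕ) → (∀ i → g ∣ ∣ t i - u i ∣) → g ∣ ∣ sum t - sum u ∣
∣-distance-sum {g} {zero}  t u g∣ = g ∣0
∣-distance-sum {g} {suc k} t u g∣ = ∣-distance-+ (t zero) (u zero) _ _ (g∣ zero)
  (∣-distance-sum (t ∘ suc) (u ∘ suc) (g∣ ∘ suc))

*≤sum : ∀ {s k} (t : Fin k → ℕ) → (∀ i → s ≤ t i) → k * s ≤ sum t
*≤sum {s} {zero}  t s≤t = z≤n
*≤sum {s} {suc k} t s≤t = +-mono-≤ (s≤t zero) (*≤sum (t ∘ suc) (s≤t ∘ suc))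

-- Restriction of vertex sets to the copies in a factor

∁-tabulate : ∀ {n} (S : Fin n → Bool) → ∁ (tabulate S) ≡ tabulate (not ∘ S)
∁-tabulate S = sym (tabulate-∘ not S)

-- These are the unions of components. Stated along edges instead of paths, the condition is
-- decidable and passes directly to each copy.
Closed : ∀ {n} → Graph n → Subset n → Set
Closed G X = ∀ u v → Edge G u v → lookup X u ≡ lookup X v

module _ {h N : ℕ} .{{_ : NonZero h}} {H : Graph h} {G : Graph N}
         (N/h*h≡N : N / h * h ≡ N) (factor : HFactor H G) where

  private
    φ : Fin (N / h) → Fin h → Fin N
    φ i = embed (proj₁ factor i)

    trace : Subset N → Fin (N / h) → Subset h
    trace X i = tabulate (lookup X ∘ φ i)

    lookup-trace : ∀ X i u → lookup (trace X i) u ≡ lookup X (φ i u)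
    lookup-trace X i = lookup∘tabulate (lookup X ∘ φ i)

    trace-∁ : ∀ X i → ∁ (trace X i) ≡ trace (∁ X) i
    trace-∁ X i = trans (∁-tabulate (lookup X ∘ φ i))
      (tabulate-cong (λ u → sym (lookup-map (φ i u) not X)))

    trace-proper : ∀ X → Proper₂ G X → ∀ i → Proper₂ H (trace X i)
    trace-proper X proper i u v e eq = proper (φ i u) (φ i v) (edges (proj₁ factor i) u v e)
      (trans (sym (lookup-trace X i u)) (trans eq (lookup-trace X i v)))

    trace-closed : ∀ X → Closed G X → ∀ i → Closed H (trace X i)
    trace-closed X closed i u v e = trans (lookup-trace X i u)
      (trans (closed (φ i u) (φ i v) (edges (proj₁ factor i) u v e)) (sym (lookup-trace X i v)))

  -- The copies are disjoint and, since `h` divides `N`, leave no vertex uncovered, so `X` is the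
  -- disjoint union of its parts inside the copies.
  ∣∣-factor : ∀ X → sum (λ i → ∣ trace X i ∣) ≡ ∣ X ∣
  ∣∣-factor X = begin
    sum (λ i → ∣ trace X i ∣)
      ≡⟨ sum-cong-≗ (λ i → ∣tabulate∣ (lookup X ∘ φ i)) ⟩
    sum (λ i → sum ((λ v → if lookup X v then 1 else 0) ∘ φ i))
      ≡⟨ sum-disjoint-images N/h*h≡N _ φ (λ i → injective (proj₁ factor i)) (proj₂ factor) ⟩
    sum (λ v → if lookup X v then 1 else 0)
      ≡⟨ ∣tabulate∣ (lookup X) ⟨
    ∣ tabulate (lookup X) ∣
      ≡⟨ cong ∣_∣ (tabulate∘lookup X) ⟩
    ∣ X ∣ ∎
    where open ≡-Reasoning

  closed-factor : ∀ {d} → (∀ X → Closed H X → d ∣ ∣ X ∣) → ∀ X → Closed G X → d ∣ ∣ X ∣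
  closed-factor {d} d∣H X closed = subst (d ∣_) (∣∣-factor X)
    (∣-sum _ (λ i → d∣H (trace X i) (trace-closed X closed i)))

  D-factor : ∀ {g} → (∀ x → D H x → g ∣ x) → ∀ X → Proper₂ G X → g ∣ ∣ ∣ X ∣ - ∣ ∁ X ∣ ∣
  D-factor {g} g∣D X proper =
    subst₂ (λ x y → g ∣ ∣ x - y ∣) (∣∣-factor X) (∣∣-factor (∁ X))
      (∣-distance-sum _ _ λ i → g∣D _
        (trace X i , trace-proper X proper i ,
         cong (λ Y → ∣ ∣ trace X i ∣ - ∣ Y ∣ ∣) (trace-∁ X i)))

  σ-factor : ∀ {σ} → Isσ H σ → ∀ X → Proper₂ G X → N / h * σ ≤ ∣ X ∣
  σ-factor (_ , least) X proper = ≤-trans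
    (*≤sum _ (λ i → least _ (trace X i , trace-proper X proper i , refl)))
    (≤-reflexive (∣∣-factor X))

-- Blow-ups and disjoint unions of two bicliques

module _ {A : Set} (joined : A → A → Bool) (joined-sym : ∀ x y → joined x y ≡ joined y x)
         (joined-irrefl : ∀ x → joined x x ≡ false) {N : ℕ} (label : Vec A N) where

  -- Each label becomes an independent set, one vertex per occurrence in `label`. Degrees and class
  -- sizes thus reduce to counting labels.
  blowUp : Graph N
  blowUp = record
    { adj        = λ u v → joined (lookup label u) (lookup label v)
    ; adj-sym    = λ u v → joined-sym (lookup label u) (lookup label v)
    ; adj-irrefl = λ v → joined-irrefl (lookup label v)
    }

  blowUp-degree : ∀ v → degree blowUp v ≡ ∣ map (joined (lookup label v)) label ∣
  blowUp-degree v = cong ∣_∣ (trans (tabulate-∘ (joined (lookup label v)) (lookup label))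
    (cong (map _) (tabulate∘lookup label)))

  blowUp-proper : ∀ w → (∀ x y → T (joined x y) → w x ≢ w y) → Proper₂ blowUp (map w label)
  blowUp-proper w proper u v e eq = proper _ _ e
    (trans (sym (lookup-map u w label)) (trans eq (lookup-map v w label)))

  blowUp-closed : ∀ w → (∀ x y → T (joined x y) → w x ≡ w y) → Closed blowUp (map w label)
  blowUp-closed w closed u v e =
    trans (lookup-map u w label) (trans (closed _ _ e) (sym (lookup-map v w label)))

∣map-replicate∣ : ∀ {A : Set} (w : A → Bool) k x {m} (ys : Vec A m) →
  ∣ map w (replicate k x ++ ys) ∣ ≡ (if w x then k else 0) + ∣ map w ys ∣
∣map-replicate∣ w zero    x ys with w x
... | true  = refl
... | false = refl
∣map-replicate∣ w (suc k) x ys with w x | ∣map-replicate∣ w k x ys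
... | true  | eq = cong suc eq
... | false | eq = eq

lookup-replicate-++ : ∀ {A : Set} k .{{_ : NonZero k}} (x : A) {m} (ys : Vec A m) →
  ∃ λ v → lookup (replicate k x ++ ys) v ≡ x
lookup-replicate-++ (suc k) x ys = zero , refl

-- (side , part): the side of the bipartition and the biclique of a vertex.
Block : Set
Block = Bool × Bool

pattern B₁ = false , true
pattern A₁ = true  , true
pattern A₂ = true  , false
pattern B₂ = false , false

joined : Block → Block → Bool
joined (s , p) (s′ , p′) = (s xor s′) ∧ not (p xor p′)

joined-sym : ∀ x y → joined x y ≡ joined y x
joined-sym B₁ B₁ = refl
joined-sym B₁ A₁ = refl
joined-sym B₁ A₂ = refl
joined-sym B₁ B₂ = refl
joined-sym A₁ B₁ = refl
joined-sym A₁ A₁ = refl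
joined-sym A₁ A₂ = refl
joined-sym A₁ B₂ = refl
joined-sym A₂ B₁ = refl
joined-sym A₂ A₁ = refl
joined-sym A₂ A₂ = refl
joined-sym A₂ B₂ = refl
joined-sym B₂ B₁ = refl
joined-sym B₂ A₁ = refl
joined-sym B₂ A₂ = refl
joined-sym B₂ B₂ = refl

joined-irrefl : ∀ x → joined x x ≡ false
joined-irrefl B₁ = refl
joined-irrefl A₁ = refl
joined-irrefl A₂ = refl
joined-irrefl B₂ = refl

side part twisted : Block → Bool
side (s , p) = s
part (s , p) = p
-- The other 2-colouring of the two bicliques, with class A₁ ∪ B₂.
twisted (s , p) = not (s xor p)

side-proper : ∀ x y → T (joined x y) → side x ≢ side y
side-proper B₁ A₁ _ ()
side-proper A₁ B₁ _ ()
side-proper A₂ B₂ _ ()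
side-proper B₂ A₂ _ ()

twisted-proper : ∀ x y → T (joined x y) → twisted x ≢ twisted y
twisted-proper B₁ A₁ _ ()
twisted-proper A₁ B₁ _ ()
twisted-proper A₂ B₂ _ ()
twisted-proper B₂ A₂ _ ()

part-closed : ∀ x y → T (joined x y) → part x ≡ part y
part-closed B₁ A₁ _ = refl
part-closed A₁ B₁ _ = refl
part-closed A₂ B₂ _ = refl
part-closed B₂ A₂ _ = refl

-- The sizes of A₁, B₁, A₂ and B₂, in this order.
module TwoBicliques (a b c e : ℕ) where

  -- `B₁` comes first so that `lookup-replicate-++` finds a vertex in it: its vertices are the ones
  -- of degree `a`.
  label : Vec Block (b + (a + (c + (e + 0))))
  label = replicate b B₁ ++ replicate a A₁ ++ replicate c A₂ ++ replicate e B₂ ++ []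

  G : Graph (b + (a + (c + (e + 0))))
  G = blowUp joined joined-sym joined-irrefl label

  class : (Block → Bool) → Subset (b + (a + (c + (e + 0))))
  class w = map w label

  weight : (Block → Bool) → ℕ
  weight w = (if w B₁ then b else 0) + ((if w A₁ then a else 0) +
             ((if w A₂ then c else 0) + ((if w B₂ then e else 0) + 0)))

  ∣class∣ : ∀ w → ∣ class w ∣ ≡ weight w
  ∣class∣ w =
    trans (∣map-replicate∣ w b B₁ _) (cong (_+_ _)
    (trans (∣map-replicate∣ w a A₁ _) (cong (_+_ _)
    (trans (∣map-replicate∣ w c A₂ _) (cong (_+_ _) (∣map-replicate∣ w e B₂ []))))))

  ∣∁class∣ : ∀ w → ∣ ∁ (class w) ∣ ≡ weight (not ∘ w)
  ∣∁class∣ w = trans (cong ∣_∣ (sym (map-∘ not w label))) (∣class∣ (not ∘ w))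

  balanced : a + c ≡ b + e → BalancedBipartite G
  balanced a+c≡b+e = class side ,
    blowUp-proper joined joined-sym joined-irrefl label side side-proper ,
    trans (∣class∣ side) (trans (cong (_+_ a) (+-identityʳ c))
      (trans a+c≡b+e (sym (trans (∣∁class∣ side) (cong (_+_ b) (+-identityʳ e))))))

  -- A vertex is adjacent to the opposite side of its own biclique, so the degrees on `B₁`, `A₁`,
  -- `A₂` and `B₂` are `a`, `b`, `e` and `c`. The value `a` is attained because `B₁` is nonempty.
  minDegree : .{{NonZero b}} → a ≤ b → a ≤ c → a ≤ e → IsMinDegree G a
  minDegree a≤b a≤c a≤e = attained ,
    λ { _ (v , refl) → subst (a ≤_) (sym (degree≡ v)) (a≤weight (lookup label v)) }
    where
    degree≡ : ∀ v → degree G v ≡ weight (joined (lookup label v))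
    degree≡ v = trans (blowUp-degree joined joined-sym joined-irrefl label v) (∣class∣ _)

    a≤weight : ∀ x → a ≤ weight (joined x)
    a≤weight B₁ = m≤m+n a 0
    a≤weight A₁ = m≤n⇒m≤n+o 0 a≤b
    a≤weight A₂ = m≤n⇒m≤n+o 0 a≤e
    a≤weight B₂ = m≤n⇒m≤n+o 0 a≤c

    attained : ∃ λ v → degree G v ≡ a
    attained with v , eq ← lookup-replicate-++ b B₁ _ =
      v , trans (degree≡ v) (trans (cong (weight ∘ joined) eq) (+-identityʳ a))

-- The closed set is the first biclique `A₁ ∪ B₁`; the proper colouring is the twisted one, with
-- classes `A₁ ∪ B₂` and `B₁ ∪ A₂`.
twoBicliques : ∀ {N} a b c e .{{_ : NonZero b}} → b + (a + (c + (e + 0))) ≡ N →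
  a ≤ b → a ≤ c → a ≤ e → a + c ≡ b + e →
  Σ[ G ∈ Graph N ] (BalancedBipartite G × IsMinDegree G a
    × (Σ[ X ∈ Subset N ] (Closed G X × ∣ X ∣ ≡ b + a))
    × (Σ[ X ∈ Subset N ] (Proper₂ G X × ∣ X ∣ ≡ a + e × ∣ ∁ X ∣ ≡ b + c)))
twoBicliques a b c e refl a≤b a≤c a≤e a+c≡b+e =
  G , balanced a+c≡b+e , minDegree a≤b a≤c a≤e ,
  (class part , blowUp-closed joined joined-sym joined-irrefl label part part-closed ,
    trans (∣class∣ part) (cong (_+_ b) (+-identityʳ a))) ,
  (class twisted , blowUp-proper joined joined-sym joined-irrefl label twisted twisted-proper ,
    trans (∣class∣ twisted) (cong (_+_ a) (+-identityʳ e)) ,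
    trans (∣∁class∣ twisted) (cong (_+_ b) (+-identityʳ c)))
  where open TwoBicliques a b c e

-- Common divisors witnessing that the hcf is not 1

∣∩∣+∣∩∁∣ : ∀ {n} (X Y : Subset n) → ∣ X ∣ ≡ ∣ Y ∩ X ∣ + ∣ ∁ Y ∩ X ∣
∣∩∣+∣∩∁∣ []          []          = refl
∣∩∣+∣∩∁∣ (false ∷ X) (false ∷ Y) = ∣∩∣+∣∩∁∣ X Y
∣∩∣+∣∩∁∣ (false ∷ X) (true  ∷ Y) = ∣∩∣+∣∩∁∣ X Y
∣∩∣+∣∩∁∣ (true  ∷ X) (false ∷ Y) = trans (cong suc (∣∩∣+∣∩∁∣ X Y)) (sym (+-suc _ _))
∣∩∣+∣∩∁∣ (true  ∷ X) (true  ∷ Y) = cong suc (∣∩∣+∣∩∁∣ X Y)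

∈⇒0<∣∣ : ∀ {n} {X : Subset n} {v} → v ∈ X → 0 < ∣ X ∣
∈⇒0<∣∣ v∈X = ≤-<-trans z≤n (x∈p⇒∣p-x∣<∣p∣ v∈X)

allSubset? : ∀ {n} {P : Subset n → Set} → Decidable P → Dec (∀ X → P X)
allSubset? P? = map′ (λ ∄ X → decidable-stable (P? X) (λ ¬P → ∄ (X , ¬P)))
                     (λ { ∀P (X , ¬P) → ¬P (∀P X) }) (¬? (anySubset? (¬? ∘ P?)))

module _ {n} (G : Graph n) where

  private
    edgewise? : ∀ {P : Fin n → Fin n → Set} → (∀ u v → Dec (P u v)) → Dec (∀ u v → Edge G u v → P u v)
    edgewise? P? = Fin.all? λ u → Fin.all? λ v → Bool.T? (adj G u v) →-dec P? u v

  closed? : Decidable (Closed G)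
  closed? X = edgewise? λ u v → lookup X u Bool.≟ lookup X v

  proper₂? : Decidable (Proper₂ G)
  proper₂? X = edgewise? λ u v → ¬? (lookup X u Bool.≟ lookup X v)

  -- Closed sets stand in for components here because `∣Closed` can be decided without deciding
  -- reachability.
  ∣Closed ∣D : ℕ → Set
  ∣Closed d = ∀ X → Closed G X → d ∣ ∣ X ∣
  ∣D g = ∀ x → D G x → g ∣ x

  ∣Closed? : Decidable ∣Closed
  ∣Closed? d = allSubset? λ X → closed? X →-dec (d ∣? ∣ X ∣)

  ∣D? : Decidable ∣D
  ∣D? g = map′ (λ { ∣D _ (X , proper , refl) → ∣D X proper }) (λ ∣D X proper → ∣D _ (X , proper , refl))
    (allSubset? λ X → proper₂? X →-dec (g ∣? ∣ ∣ X ∣ - ∣ ∁ X ∣ ∣))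

  D≤n : ∀ {x} → D G x → x ≤ n
  D≤n (X , _ , refl) = ≤-trans (∣m-n∣≤m⊔n ∣ X ∣ ∣ ∁ X ∣) (⊔-lub (∣p∣≤n X) (∣p∣≤n (∁ X)))

  Reachable : Fin n → Fin n → Set
  Reachable = Star (Edge G)

  closed-reachable : ∀ X → Closed G X → ∀ {u v} → Reachable u v → lookup X u ≡ lookup X v
  closed-reachable X closed ε        = refl
  closed-reachable X closed (e ◅ es) = trans (closed _ _ e) (closed-reachable X closed es)

  module _ (reachable? : ∀ u v → Dec (Reachable u v)) where

    component : Fin n → Subset n
    component v = tabulate (does ∘ reachable? v)

    ∈-component : ∀ v w → w ∈ component v ⇔ Reachable v w
    ∈-component v w = mk⇔
      (λ w∈C → invert (trans (sym (lookup∘tabulate _ w)) ([]=⇒lookup w∈C)))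
      (λ r → lookup⇒[]= w _ (trans (lookup∘tabulate _ w) (dec-true (reachable? v w) r)))
      where
      invert : does (reachable? v w) ≡ true → Reachable v w
      invert with reachable? v w
      ... | yes r = λ _ → r
      ... | no _  = λ ()

    component-closed : ∀ v → Closed G (component v)
    component-closed v u w e = trans (lookup∘tabulate _ u) (trans
      (does-⇔ (mk⇔ (_◅◅ (e ◅ ε)) (_◅◅ (subst T (adj-sym G u w) e ◅ ε))) (reachable? v u) (reachable? v w))
      (sym (lookup∘tabulate _ w)))

    -- A closed set containing `v` contains the whole component of `v`, so the intersection is that
    -- component. The form matches the splitting of `∣ X ∣` in `∣∩∣+∣∩∁∣`.
    ∈-component∩ : ∀ {X v} → Closed G X → v ∈ X → ∀ w → w ∈ component v ∩ X ⇔ Reachable v w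
    ∈-component∩ {X} {v} closed v∈X w = mk⇔
      (to (∈-component v w) ∘ proj₁ ∘ x∈p∩q⁻ _ _)
      (λ r → x∈p∩q⁺ (from (∈-component v w) r ,
        lookup⇒[]= w X (trans (sym (closed-reachable X closed r)) ([]=⇒lookup v∈X))))
      where open Equivalence

    rest-closed : ∀ X v → Closed G X → Closed G (∁ (component v) ∩ X)
    rest-closed X v closed u w e = begin
      lookup (∁ C ∩ X) u            ≡⟨ lookup-∁∩ u ⟩
      not (lookup C u) ∧ lookup X u ≡⟨ cong₂ (λ x y → not x ∧ y) (component-closed v u w e) (closed u w e) ⟩
      not (lookup C w) ∧ lookup X w ≡⟨ lookup-∁∩ w ⟨
      lookup (∁ C ∩ X) w            ∎
      where
      open ≡-Reasoning
      C = component v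
      lookup-∁∩ : ∀ u → lookup (∁ C ∩ X) u ≡ not (lookup C u) ∧ lookup X u
      lookup-∁∩ u = trans (lookup-zipWith _∧_ u (∁ C) X) (cong (_∧ lookup X u) (lookup-map u not C))

    -- Strong induction on `∣ X ∣`: remove the component of some vertex of `X`; what is left is
    -- closed and strictly smaller.
    ∣components⇒∣closed : ∀ {d} → (∀ k → ComponentSize G k → d ∣ k) →
                          ∀ X → Acc _<_ ∣ X ∣ → Closed G X → d ∣ ∣ X ∣
    ∣components⇒∣closed {d} d∣ X (acc rec) closed with nonempty? X
    ... | no empty = subst (d ∣_) (sym (trans (cong ∣_∣ (Empty-unique empty)) (∣⊥∣≡0 n))) (d ∣0)
    ... | yes (v , v∈X) = subst (d ∣_) (sym split) (∣m∣n⇒∣m+n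
          (d∣ _ (v , component v ∩ X , ∈-component∩ closed v∈X , refl))
          (∣components⇒∣closed d∣ (∁ (component v) ∩ X) (rec smaller) (rest-closed X v closed)))
      where
      split = ∣∩∣+∣∩∁∣ X (component v)
      0<∣C∩X∣ : 0 < ∣ component v ∩ X ∣
      0<∣C∩X∣ = ∈⇒0<∣∣ (Equivalence.from (∈-component∩ closed v∈X v) ε)
      smaller : ∣ ∁ (component v) ∩ X ∣ < ∣ X ∣
      smaller = subst (∣ ∁ (component v) ∩ X ∣ <_) (sym split) (m<n+m _ 0<∣C∩X∣)

  -- Reachability may be decided classically when the goal is decidable.
  reachable?-stable : ∀ {P : Set} → Dec P → ((∀ u v → Dec (Reachable u v)) → P) → P
  reachable?-stable P? f = decidable-stable P? (¬¬-map f
    (Fin.sequence applicative λ u → Fin.sequence applicative λ v → ¬¬-excluded-middle))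
    where applicative = RawMonad.rawApplicative (¬¬-Monad {a = 0ℓ})

  -- The full vertex set is closed, so a `d` with `∣Closed d` divides `n`. As `n` is nonzero, `d` is
  -- nonzero and at most `n`, and the bound `suc n` misses no candidate.
  ¬∣Closed⇒hcf≡1 : .{{_ : NonZero n}} → ¬ (∃ λ d → d < suc n × (2 ≤ d × ∣Closed d)) →
                   IsHCF (ComponentSize G) 1
  ¬∣Closed⇒hcf≡1 ∄ = (λ x _ → 1∣ x) , λ d d∣components →
    reachable?-stable (d ∣? 1) λ reachable? → ∣Closed⇒∣1 d λ X →
      ∣components⇒∣closed reachable? d∣components X (<-wellFounded _)
    where
    ∣Closed⇒∣1 : ∀ d → ∣Closed d → d ∣ 1
    ∣Closed⇒∣1 d d∣closed with d∣n ← subst (d ∣_) (∣⊤∣≡n n) (d∣closed ⊤ λ u v _ →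
      trans (lookup-replicate u true) (sym (lookup-replicate v true))) | d
    ... | zero          = contradiction (0∣⇒≡0 d∣n) (≢-nonZero⁻¹ n)
    ... | suc zero      = ∣-refl
    ... | suc (suc d-2) = contradiction (_ , s≤s (∣⇒≤ d∣n) , s≤s (s≤s z≤n) , d∣closed) ∄

  -- All elements of D G are at most n, so g > n divides them only if they
  -- all vanish; then g = 3 does too, and 3 < 4 + n for every n.
  module _ (∄ : ¬ (∃ λ g → g < 4 + n × (3 ≤ g × ∣D g))) where

    D≢0 : ¬ (∀ x → D G x → x ≡ 0)
    D≢0 D≡0 = ∄ (3 , m<m+n 3 z<s , ≤-refl , λ x x∈D → subst (3 ∣_) (sym (D≡0 x x∈D)) (3 ∣0))

    ∣D⇒≡1⊎≡2 : ∀ g → ∣D g → g ≡ 1 ⊎ g ≡ 2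
    ∣D⇒≡1⊎≡2 0 0∣D = contradiction (λ x x∈D → 0∣⇒≡0 (0∣D x x∈D)) D≢0
    ∣D⇒≡1⊎≡2 1 _   = inj₁ refl
    ∣D⇒≡1⊎≡2 2 _   = inj₂ refl
    ∣D⇒≡1⊎≡2 g@(suc (suc (suc _))) g∣D with g <? 4 + n
    ... | yes g<4+n = contradiction (g , g<4+n , s≤s (s≤s (s≤s z≤n)) , g∣D) ∄
    ... | no  g≮4+n = contradiction D≡0 D≢0
      where
      D≡0 : ∀ x → D G x → x ≡ 0
      D≡0 zero    _   = refl
      D≡0 (suc x) x∈D = contradiction
        (≤-trans (∣⇒≤ (g∣D _ x∈D)) (≤-trans (D≤n x∈D) (m≤n+m n 3))) (g≮4+n ∘ s≤s)

    ¬∣D⇒hcfχ≤2 : ∃ λ g → IsHCFχ G g × NonStrict._≤⁺_ _≤_ g [ 2 ]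
    ¬∣D⇒hcfχ≤2 = [ hcf .proj₁ ] ,
                 finite (λ D⇔0 → D≢0 λ x → Equivalence.to (D⇔0 x)) (hcf .proj₂ .proj₁) ,
                 NonStrict.[ hcf .proj₂ .proj₂ ]
      where
      hcf : ∃ λ g → IsHCF (D G) g × g ≤ 2
      -- Only 1 and 2 can divide all of `D G`, so whether 2 does decides the hcf.
      hcf with ∣D? 2
      ... | yes 2∣D = 2 , (2∣D , λ d d∣D → [ (λ { refl → 1∣ 2 }) , (λ { refl → ∣-refl }) ]′
        (∣D⇒≡1⊎≡2 d d∣D)) , ≤-refl
      ... | no  2∤D = 1 , ((λ x _ → 1∣ x) ,
        λ d d∣D → [ (λ { refl → ∣-refl }) , (λ { refl → contradiction d∣D 2∤D }) ]′ (∣D⇒≡1⊎≡2 d d∣D)) , s≤s z≤n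

  -- To obtain a witness from a negation, both alternatives are decided by bounded search; if both
  -- fail, `HCF≡1 G` follows.
  hcf≢1⇒ : .{{_ : NonZero n}} → ¬ HCF≡1 G → (∃ λ d → 2 ≤ d × ∣Closed d) ⊎ (∃ λ g → 3 ≤ g × ∣D g)
  hcf≢1⇒ hcf≢1 with anyUpTo? (λ d → 2 ≤? d ×-dec ∣Closed? d) (suc n)
                  | anyUpTo? (λ g → 3 ≤? g ×-dec ∣D? g) (4 + n)
  ... | yes (d , _ , ∃d) | _                = inj₁ (d , ∃d)
  ... | no _             | yes (g , _ , ∃g) = inj₂ (g , ∃g)
  ... | no ∄d            | no ∄g            = contradiction (¬∣Closed⇒hcf≡1 ∄d , ¬∣D⇒hcfχ≤2 ∄g) hcf≢1

-- Evaluation of the rational degree bound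

toℚᵘ-/ : ∀ p q-1 → toℚᵘ (p ℚ./ suc q-1) ≃ mkℚᵘ p q-1
toℚᵘ-/ p q-1 = ℚ.toℚᵘ-fromℚᵘ (mkℚᵘ p q-1)

-- Working up to `≃` with an arbitrary fraction for `x` avoids computing lowest terms.
toℚᵘ-1/ : ∀ x .{{_ : ℚ.NonZero x}} {p-1 q-1} → toℚᵘ x ≃ mkℚᵘ +[1+ p-1 ] q-1 →
          toℚᵘ (ℚ.1/ x) ≃ mkℚᵘ +[1+ q-1 ] p-1
toℚᵘ-1/ (mkℚ +[1+ n ] d-1 _) {p-1} {q-1} (*≡* eq) = *≡* (trans (ℤ.*-comm +[1+ d-1 ] +[1+ p-1 ])
  (trans (sym eq) (ℤ.*-comm +[1+ n ] +[1+ q-1 ])))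

floor≡↥/ℕ↧ : ∀ p → ℚ.floor p ≡ ↥ p ℤ./ℕ ↧ₙ p
floor≡↥/ℕ↧ p@record{} = ℤ.div-pos-is-/ℕ (↥ p) (↧ₙ p)

-- The ceiling is `- f` for the floor `f` of `- x`. From `2f ≤ - k < 2(f + 1)` follows
-- `k ≤ 2c < k + 2` for `c = - f`, which determines `c`.
ceiling-half : ∀ x k → toℚᵘ x ≃ mkℚᵘ (+ k) 1 → ceiling x ≡ + ⌈ k /2⌉
ceiling-half x@record{} k (*≡* ↥x*2≡k*↧x) = from-bounds (ceiling x) lower upper
  where
  open ℤ.≤-Reasoning
  p = ℚ.- x
  f = ℚ.floor p

  ↥p*2≡-k*↧p : ↥ p ℤ.* + 2 ≡ ℤ.- + k ℤ.* ↧ p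
  ↥p*2≡-k*↧p = begin-equality
    ↥ p ℤ.* + 2          ≡⟨ cong (ℤ._* + 2) (ℚ.↥-neg x) ⟩
    ℤ.- ↥ x ℤ.* + 2      ≡⟨ ℤ.neg-distribˡ-* (↥ x) (+ 2) ⟨
    ℤ.- (↥ x ℤ.* + 2)    ≡⟨ cong ℤ.-_ ↥x*2≡k*↧x ⟩
    ℤ.- (+ k ℤ.* ↧ x)    ≡⟨ ℤ.neg-distribˡ-* (+ k) (↧ x) ⟩
    ℤ.- + k ℤ.* ↧ x      ≡⟨ cong (ℤ.- + k ℤ.*_) (ℚ.↧-neg x) ⟨
    ℤ.- + k ℤ.* ↧ p      ∎

  swap : ∀ f d → f ℤ.* + 2 ℤ.* d ≡ f ℤ.* d ℤ.* + 2
  swap = ℤ-solve-∀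

  2f≤-k : f ℤ.* + 2 ℤ.≤ ℤ.- + k
  2f≤-k = ℤ.*-cancelʳ-≤-pos _ _ (↧ p) (begin
    f ℤ.* + 2 ℤ.* ↧ p  ≡⟨ swap f (↧ p) ⟩
    f ℤ.* ↧ p ℤ.* + 2  ≡⟨ cong (λ f → f ℤ.* ↧ p ℤ.* + 2) (floor≡↥/ℕ↧ p) ⟩
    (↥ p ℤ./ℕ ↧ₙ p) ℤ.* ↧ p ℤ.* + 2  ≤⟨ ℤ.*-monoʳ-≤-nonNeg (+ 2) (ℤ.[n/ℕd]*d≤n (↥ p) (↧ₙ p)) ⟩
    ↥ p ℤ.* + 2        ≡⟨ ↥p*2≡-k*↧p ⟩
    ℤ.- + k ℤ.* ↧ p    ∎)

  -k<2[1+f] : ℤ.- + k ℤ.< ℤ.suc f ℤ.* + 2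
  -k<2[1+f] = ℤ.*-cancelʳ-<-nonNeg (↧ p) (begin-strict
    ℤ.- + k ℤ.* ↧ p                     ≡⟨ ↥p*2≡-k*↧p ⟨
    ↥ p ℤ.* + 2                         <⟨ ℤ.*-monoʳ-<-pos (+ 2) (ℤ.n<s[n/ℕd]*d (↥ p) (↧ₙ p)) ⟩
    ℤ.suc (↥ p ℤ./ℕ ↧ₙ p) ℤ.* ↧ p ℤ.* + 2  ≡⟨ cong (λ f → ℤ.suc f ℤ.* ↧ p ℤ.* + 2) (floor≡↥/ℕ↧ p) ⟨
    ℤ.suc f ℤ.* ↧ p ℤ.* + 2             ≡⟨ swap (ℤ.suc f) (↧ p) ⟨
    ℤ.suc f ℤ.* + 2 ℤ.* ↧ p             ∎)

  lower : + k ℤ.≤ ceiling x ℤ.* + 2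
  lower = begin
    + k                  ≡⟨ ℤ.neg-involutive (+ k) ⟨
    ℤ.- (ℤ.- + k)        ≤⟨ ℤ.neg-mono-≤ 2f≤-k ⟩
    ℤ.- (f ℤ.* + 2)      ≡⟨ ℤ.neg-distribˡ-* f (+ 2) ⟩
    ceiling x ℤ.* + 2    ∎

  upper : ceiling x ℤ.* + 2 ℤ.< + (2 + k)
  upper = begin-strict
    ceiling x ℤ.* + 2               ≡⟨ shift f ⟩
    + 2 ℤ.+ ℤ.- (ℤ.suc f ℤ.* + 2)   <⟨ ℤ.+-monoʳ-< (+ 2) (ℤ.neg-mono-< -k<2[1+f]) ⟩
    + 2 ℤ.+ ℤ.- (ℤ.- + k)           ≡⟨ cong (ℤ._+_ (+ 2)) (ℤ.neg-involutive (+ k)) ⟩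
    + (2 + k)                     ∎
    where
    shift : ∀ f → ℤ.- f ℤ.* + 2 ≡ + 2 ℤ.+ ℤ.- ((1ℤ ℤ.+ f) ℤ.* + 2)
    shift = ℤ-solve-∀

  from-bounds : ∀ c → + k ℤ.≤ c ℤ.* + 2 → c ℤ.* + 2 ℤ.< + (2 + k) → c ≡ + ⌈ k /2⌉
  -- `⌈ k /2⌉` unfolds to `⌊ suc k /2⌋`, so halving `k ≤ c + c ≤ suc k` gives both inequalities. A
  -- negative `c` violates the lower bound.
  from-bounds (+ c) k≤2c 2c<2+k = cong +_ (≤-antisym
    (subst (_≤ ⌈ k /2⌉) (sym (n≡⌊n+n/2⌋ c)) (⌊n/2⌋-mono (s≤s⁻¹ (subst (_< 2 + k) c*2≡c+c
      (ℤ.drop‿+<+ (subst (ℤ._< + (2 + k)) (sym (ℤ.pos-* c 2)) 2c<2+k))))))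
    (subst (⌈ k /2⌉ ≤_) (sym (n≡⌈n+n/2⌉ c)) (⌈n/2⌉-mono (subst (k ≤_) c*2≡c+c
      (ℤ.drop‿+≤+ (subst (+ k ℤ.≤_) (sym (ℤ.pos-* c 2)) k≤2c))))))
    where
    c*2≡c+c : c * 2 ≡ c + c
    c*2≡c+c = trans (*-comm c 2) (cong (_+_ c) (+-identityʳ c))

-- `1 - s / h = σ / h` because `h = s + σ`. A general `s` in place of `h ∸ σ` can be matched as a
-- successor.
1-1/[h/s]≃σ/h : ∀ h-1 {σ s} .{{_ : NonZero s}} → let h = suc h-1; χ = + (1 * h) ℚ./ s in
  .{{_ : ℚ.NonZero χ}} → s + σ ≡ h → toℚᵘ (ℚ.1ℚ ℚ.- ℚ.1/ χ) ≃ mkℚᵘ (+ σ) h-1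
1-1/[h/s]≃σ/h h-1 {σ} {s@(suc s-1)} s+σ≡h = begin
  toℚᵘ (ℚ.1ℚ ℚ.- ℚ.1/ χ)               ≈⟨ ℚ.toℚᵘ-homo-+ ℚ.1ℚ (ℚ.- (ℚ.1/ χ)) ⟩
  ℚᵘ.1ℚᵘ ℚᵘ.+ toℚᵘ (ℚ.- (ℚ.1/ χ))      ≈⟨ ℚᵘ.+-congʳ ℚᵘ.1ℚᵘ (ℚ.toℚᵘ-homo‿- (ℚ.1/ χ)) ⟩
  ℚᵘ.1ℚᵘ ℚᵘ.- toℚᵘ (ℚ.1/ χ)            ≈⟨ ℚᵘ.+-congʳ ℚᵘ.1ℚᵘ (ℚᵘ.-‿cong (toℚᵘ-1/ χ χ≃h/s)) ⟩
  ℚᵘ.1ℚᵘ ℚᵘ.- mkℚᵘ (+ s) h-1           ≈⟨ *≡* cross ⟩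
  mkℚᵘ (+ σ) h-1                       ∎
  where
  open ℚᵘ.≃-Reasoning
  χ = + (1 * suc h-1) ℚ./ s

  χ≃h/s : toℚᵘ χ ≃ mkℚᵘ +[1+ h-1 ] s-1
  χ≃h/s = subst (λ h → toℚᵘ χ ≃ mkℚᵘ (+ h) s-1) (*-identityˡ (suc h-1)) (toℚᵘ-/ _ s-1)

  h≡ : + suc h-1 ≡ + s ℤ.+ + σ
  h≡ = cong +_ (sym s+σ≡h)

  cancel : ∀ s σ → (1ℤ ℤ.* (s ℤ.+ σ) ℤ.+ ℤ.- s ℤ.* 1ℤ) ℤ.* (s ℤ.+ σ) ≡ σ ℤ.* (1ℤ ℤ.* (s ℤ.+ σ))
  cancel = ℤ-solve-∀

  cross : (1ℤ ℤ.* + suc h-1 ℤ.+ ℤ.- + s ℤ.* 1ℤ) ℤ.* + suc h-1 ≡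
          + σ ℤ.* (1ℤ ℤ.* + suc h-1)
  cross = trans (cong (λ h → (1ℤ ℤ.* h ℤ.+ ℤ.- + s ℤ.* 1ℤ) ℤ.* h) h≡)
    (trans (cancel (+ s) (+ σ)) (cong (λ h → + σ ℤ.* (1ℤ ℤ.* h)) (sym h≡)))

[σ/h]n≃[mσ]/2 : ∀ σ n m h-1 → 2 * n ≡ m * suc h-1 →
  mkℚᵘ (+ σ) h-1 ℚᵘ.* mkℚᵘ (+ n) 0 ≃ mkℚᵘ (+ (m * σ)) 1
[σ/h]n≃[mσ]/2 σ n m h-1 2n≡mh = *≡* (begin
  + σ ℤ.* + n ℤ.* + 2           ≡⟨ cong (ℤ._* + 2) (ℤ.pos-* σ n) ⟨
  + (σ * n) ℤ.* + 2           ≡⟨ ℤ.pos-* (σ * n) 2 ⟨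
  + (σ * n * 2)             ≡⟨ cong +_ (regroup σ n) ⟩
  + (σ * (2 * n))           ≡⟨ cong (λ x → + (σ * x)) 2n≡mh ⟩
  + (σ * (m * h))           ≡⟨ cong +_ (regroup′ σ m h) ⟩
  + (m * σ * (h * 1))     ≡⟨ ℤ.pos-* (m * σ) (h * 1) ⟩
  + (m * σ) ℤ.* + (h * 1)   ∎)
  where
  open ≡-Reasoning
  h = suc h-1
  regroup : ∀ σ n → σ * n * 2 ≡ σ * (2 * n)
  regroup = ℕ-solve-∀
  regroup′ : ∀ σ m h → σ * (m * h) ≡ m * σ * (h * 1)
  regroup′ = ℕ-solve-∀

-- By `2 * n ≡ m * h`, the product `(σ / h) n` is `mσ / 2`, which may be a half-integer.
ceiling-[1-1/χcr]n : ∀ {h} .{{_ : NonZero h}} (H : Graph h) {σ} (isσ : Isσ H σ) m n → 2 * n ≡ m * h →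
  ceiling (1-1/χcr H isσ ℚ.* (+ n ℚ./ 1)) ≡ + ⌈ m * σ /2⌉
ceiling-[1-1/χcr]n {h@(suc h-1)} H {σ} isσ@((X , _ , ∣X∣≡σ) , _) m n 2n≡mh =
  ceiling-half _ (m * σ) (begin
    toℚᵘ (y ℚ.* (+ n ℚ./ 1))          ≈⟨ ℚ.toℚᵘ-homo-* y (+ n ℚ./ 1) ⟩
    toℚᵘ y ℚᵘ.* toℚᵘ (+ n ℚ./ 1)      ≈⟨ ℚᵘ.*-cong y≃σ/h (toℚᵘ-/ (+ n) 0) ⟩
    mkℚᵘ (+ σ) h-1 ℚᵘ.* mkℚᵘ (+ n) 0  ≈⟨ [σ/h]n≃[mσ]/2 σ n m h-1 2n≡mh ⟩
    mkℚᵘ (+ (m * σ)) 1              ∎)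
  where
  open ℚᵘ.≃-Reasoning
  y = 1-1/χcr H isσ

  y≃σ/h : toℚᵘ y ≃ mkℚᵘ (+ σ) h-1
  y≃σ/h = 1-1/[h/s]≃σ/h h-1 {{h∸σ-nonZero H isσ}} {{χcr-nonZero H isσ}}
    (m∸n+n≡m (subst (_≤ h) ∣X∣≡σ (∣p∣≤n X)))

-- Bounds on the smallest colour class

⌊n/2⌋+⌊n/2⌋≤n : ∀ n → ⌊ n /2⌋ + ⌊ n /2⌋ ≤ n
⌊n/2⌋+⌊n/2⌋≤n n = subst (⌊ n /2⌋ + ⌊ n /2⌋ ≤_) (⌊n/2⌋+⌈n/2⌉≡n n) (+-monoʳ-≤ ⌊ n /2⌋ (⌊n/2⌋≤⌈n/2⌉ n))

module _ {h : ℕ} {H : Graph h} where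

  Proper₂-∁ : ∀ X → Proper₂ H X → Proper₂ H (∁ X)
  Proper₂-∁ X proper u v e eq = proper u v e (Bool.not-injective
    (trans (sym (lookup-map u not X)) (trans eq (lookup-map v not X))))

  -- The complement of a smallest class is also a class, hence at least as large.
  σ+σ≤h : ∀ {σ} → Isσ H σ → σ + σ ≤ h
  σ+σ≤h ((X , proper , refl) , least) = subst (∣ X ∣ + ∣ X ∣ ≤_) (m+[n∸m]≡n (∣p∣≤n X))
    (+-monoʳ-≤ ∣ X ∣ (least _ (∁ X , Proper₂-∁ X proper , ∣∁p∣≡n∸∣p∣ X)))

  -- If a class is empty, all vertices lie in the other one, so there are no edges and one colour
  -- suffices.
  0<σ : ∀ {σ} → IsChromaticNumber H 2 → Isσ H σ → 0 < σ
  0<σ {suc σ} _ _ = z<s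
  0<σ {zero} (_ , least) ((X , proper , ∣X∣≡0) , _) = contradiction
    (least 1 ((λ _ → zero) , λ u v e →
      contradiction (trans (outside u) (sym (outside v))) (proper u v e)))
    λ { (s≤s ()) }
    where
    outside : ∀ u → lookup X u ≡ false
    outside u with lookup X u in eq
    ... | false = refl
    ... | true  = contradiction (subst (0 <_) ∣X∣≡0 (∈⇒0<∣∣ (lookup⇒[]= u X eq))) λ ()

-- Choice of the block sizes

FactorFree : ∀ {h} .{{_ : NonZero h}} → Graph h → ℕ → ℕ → Set
FactorFree H n δ = Σ[ G ∈ Graph (2 * n) ] (BalancedBipartite G × IsMinDegree G δ × ¬ HFactor H G)

module _ {h : ℕ} .{{_ : NonZero h}} (H : Graph h) where

  module _ (n-1 : ℕ) (h∣2n : h ∣ 2 * suc n-1) where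

    private
      -- For `n = suc n-1` this is `⌈ n /2⌉ - 1`, the required minimum degree; then `a + suc e = n`.
      a = ⌊ n-1 /2⌋
      e = n-1 ∸ a

      a≤e : a ≤ e
      a≤e = m+n≤o⇒m≤o∸n a (⌊n/2⌋+⌊n/2⌋≤n n-1)

      a+e≡n-1 : a + e ≡ n-1
      a+e≡n-1 = m+[n∸m]≡n (⌊n/2⌋≤n n-1)

      -- The first biclique has `2a + 1` vertices, and the twisted classes have sizes `a + e` and
      -- `a + e + 2`.
      [b=1+a] = twoBicliques a (suc a) (suc e) e
        (trans (regroup a e) (cong (λ x → 2 * suc x) a+e≡n-1))
        (n≤1+n a) (m≤n⇒m≤1+n a≤e) a≤e (+-suc a e)
        where
        regroup : ∀ a e → suc a + (a + (suc e + (e + 0))) ≡ 2 * suc (a + e)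
        regroup = ℕ-solve-∀

      [b=a] : .{{NonZero a}} → _
      [b=a] = twoBicliques a a (suc e) (suc e)
        (trans (regroup a e) (cong (λ x → 2 * suc x) a+e≡n-1))
        ≤-refl (m≤n⇒m≤1+n a≤e) (m≤n⇒m≤1+n a≤e) refl
        where
        regroup : ∀ a e → a + (a + (suc e + (suc e + 0))) ≡ 2 * suc (a + e)
        regroup = ℕ-solve-∀

      -- Needed for a nonempty `B₁` in `[b=a]`, which serves only when `d` divides `2a + 1`; for
      -- `a = 0` that number is 1.
      a≢0 : ∀ {d} → 2 ≤ d → d ∣ suc a + a → a ≢ 0
      a≢0 {d} 2≤d d∣1+2a a≡0 = <⇒≱ 2≤d (∣⇒≤ (subst (λ a → d ∣ suc a + a) a≡0 d∣1+2a))

    ∣D⇒factorFree : ∀ {g} → 3 ≤ g → ∣D H g → FactorFree H (suc n-1) a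
    ∣D⇒factorFree {g} 3≤g g∣D with G , bal , minDeg , _ , X , proper , ∣X∣≡ , ∣∁X∣≡ ← [b=1+a] =
      G , bal , minDeg , λ factor → <⇒≱ 3≤g (∣⇒≤ (subst (g ∣_) difference≡2
        (D-factor (m/n*n≡m h∣2n) factor g∣D X proper)))
      where
      shift : ∀ a e → suc a + suc e ≡ a + e + 2
      shift = ℕ-solve-∀
      difference≡2 : ∣ ∣ X ∣ - ∣ ∁ X ∣ ∣ ≡ 2
      difference≡2 = trans (cong₂ ∣_-_∣ ∣X∣≡ (trans ∣∁X∣≡ (shift a e))) (∣m-m+n∣≡n (a + e) 2)

    -- The first biclique can have `2a + 1` or `2a` vertices, and `d ≥ 2` cannot divide both of
    -- these consecutive numbers.
    ∣Closed⇒factorFree : ∀ {d} → 2 ≤ d → ∣Closed H d → FactorFree H (suc n-1) a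
    ∣Closed⇒factorFree {d} 2≤d d∣Closed with d ∣? suc a + a
    ... | no d∤1+2a with G , bal , minDeg , (X , closed , ∣X∣≡) , _ ← [b=1+a] =
      G , bal , minDeg , λ factor → d∤1+2a (subst (d ∣_) ∣X∣≡
        (closed-factor (m/n*n≡m h∣2n) factor d∣Closed X closed))
    ... | yes d∣1+2a with G , bal , minDeg , (X , closed , ∣X∣≡) , _ ← [b=a] {{≢-nonZero (a≢0 2≤d d∣1+2a)}} =
      G , bal , minDeg , λ factor → <⇒≱ 2≤d (∣⇒≤ (∣m+n∣m⇒∣n (subst (d ∣_) (+-comm 1 (a + a)) d∣1+2a)
        (subst (d ∣_) ∣X∣≡ (closed-factor (m/n*n≡m h∣2n) factor d∣Closed X closed))))

  -- With `k = mσ - 1` the degree `a = ⌊ k /2⌋` is `⌈ mσ /2⌉ - 1`, the largest integer with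
  -- `2a < mσ`. A factor would force the class `A₁ ∪ B₂`, of size `2a`, to have at least `mσ`
  -- vertices.
  σ-factorFree : ∀ {σ} m n → 2 * n ≡ m * h → Isσ H σ → ∀ {k} → m * σ ≡ suc k →
                 FactorFree H n ⌊ k /2⌋
  σ-factorFree {σ} m n 2n≡mh isσ {k} mσ≡1+k =
    let G , bal , minDeg , _ , X , proper , ∣X∣≡ , _ =
          twoBicliques a (n ∸ a) (n ∸ a) a {{>-nonZero (m<n⇒0<n∸m (≤-<-trans (m≤m+n a a) a+a<n))}}
            (trans (regroup a (n ∸ a)) (cong (2 *_) (m∸n+n≡m (≤-trans (m≤m+n a a) (<⇒≤ a+a<n)))))
            a≤n∸a a≤n∸a ≤-refl (+-comm a (n ∸ a))
    in  G , bal , minDeg , λ factor → <⇒≱ a+a<mσ (subst₂ _≤_ (cong (_* σ) 2n/h≡m) ∣X∣≡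
          (σ-factor (m/n*n≡m (divides m 2n≡mh)) factor isσ X proper))
    where
    a = ⌊ k /2⌋

    2n/h≡m : 2 * n / h ≡ m
    2n/h≡m = trans (/-congˡ 2n≡mh) (m*n/n≡m m h)

    regroup : ∀ a b → b + (a + (b + (a + 0))) ≡ 2 * (b + a)
    regroup = ℕ-solve-∀

    a+a<mσ : a + a < m * σ
    a+a<mσ = subst (a + a <_) (sym mσ≡1+k) (s≤s (⌊n/2⌋+⌊n/2⌋≤n k))

    mσ≤n : m * σ ≤ n
    mσ≤n = *-cancelˡ-≤ 2 (begin
      2 * (m * σ)   ≡⟨ double m σ ⟩
      m * (σ + σ)   ≤⟨ *-monoʳ-≤ m (σ+σ≤h {H = H} isσ) ⟩
      m * h         ≡⟨ 2n≡mh ⟨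
      2 * n         ∎)
      where
      open ≤-Reasoning
      double : ∀ m σ → 2 * (m * σ) ≡ m * (σ + σ)
      double = ℕ-solve-∀

    -- From `2σ ≤ h` comes `mσ ≤ n`. The strict bound makes `B₁`, of size `n ∸ a`, nonempty and `a`
    -- the smallest block size.
    a+a<n : a + a < n
    a+a<n = <-≤-trans a+a<mσ mσ≤n

    a≤n∸a : a ≤ n ∸ a
    a≤n∸a = m+n≤o⇒m≤o∸n a (<⇒≤ a+a<n)

proposition1p3 : ∀ {h : ℕ} .{{_ : NonZero h}} (H : Graph h) → IsChromaticNumber H 2 →
    ∀ (m n : ℕ) .{{_ : NonZero m}} → 2 * n ≡ m * h →
    (¬ HCF≡1 H →
    Σ[ G ∈ Graph (2 * n) ] (BalancedBipartite G
    × (∃ λ δ → IsMinDegree G δ × + δ ≡ + ⌈ n /2⌉ ℤ.- 1ℤ)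
    × ¬ HFactor H G))
    ×
    (HCF≡1 H → ∀ {σ : ℕ} (isσ : Isσ H σ) →
    Σ[ G ∈ Graph (2 * n) ] (BalancedBipartite G
    × (∃ λ δ → IsMinDegree G δ × + δ ≡ ceiling (1-1/χcr H isσ ℚ.* (+ n ℚ./ 1)) ℤ.- 1ℤ)
    × ¬ HFactor H G))
proposition1p3 {h} H χ≡2 m n 2n≡mh = hcf≢1-case n 2n≡mh , λ _ → σ-case
  where
  hcf≢1-case : ∀ n → 2 * n ≡ m * h → ¬ HCF≡1 H → Σ[ G ∈ Graph (2 * n) ] (BalancedBipartite G
    × (∃ λ δ → IsMinDegree G δ × + δ ≡ + ⌈ n /2⌉ ℤ.- 1ℤ) × ¬ HFactor H G)
  hcf≢1-case zero      0≡mh  _     = contradiction (sym 0≡mh) (≢-nonZero⁻¹ (m * h) {{m*n≢0 m h}})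
  hcf≢1-case (suc n-1) 2n≡mh hcf≢1 =
    let G , bal , minDeg , ¬factor = factorFree (hcf≢1⇒ H hcf≢1)
    in  G , bal , (_ , minDeg , refl) , ¬factor
    where
    h∣2n = divides m 2n≡mh
    factorFree : (∃ λ d → 2 ≤ d × ∣Closed H d) ⊎ (∃ λ g → 3 ≤ g × ∣D H g) →
                 FactorFree H (suc n-1) ⌊ n-1 /2⌋
    factorFree (inj₁ (d , 2≤d , d∣Closed)) = ∣Closed⇒factorFree H n-1 h∣2n 2≤d d∣Closed
    factorFree (inj₂ (g , 3≤g , g∣D))      = ∣D⇒factorFree H n-1 h∣2n 3≤g g∣D

  σ-case : ∀ {σ} (isσ : Isσ H σ) → Σ[ G ∈ Graph (2 * n) ] (BalancedBipartite G
    × (∃ λ δ → IsMinDegree G δ × + δ ≡ ceiling (1-1/χcr H isσ ℚ.* (+ n ℚ./ 1)) ℤ.- 1ℤ)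
    × ¬ HFactor H G)
  σ-case {σ} isσ with m * σ in mσ≡
  ... | zero  = contradiction mσ≡
    (≢-nonZero⁻¹ (m * σ) {{m*n≢0 m σ {{it}} {{>-nonZero (0<σ {H = H} χ≡2 isσ)}}}})
  -- After rewriting `m * σ` to `suc k`, the ceiling is `⌈ suc k /2⌉`, which computes to
  -- `suc ⌊ k /2⌋`.
  ... | suc k with G , bal , minDeg , ¬factor ← σ-factorFree H m n 2n≡mh isσ mσ≡ =
    G , bal , (_ , minDeg ,
      cong (ℤ._- 1ℤ) (sym (trans (ceiling-[1-1/χcr]n H isσ m n 2n≡mh)
        (cong (λ k → + ⌈ k /2⌉) mσ≡)))) , ¬factor
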